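{- Let $G$ be a finite simple undirected graph with $n$ vertices that has a vertex cover of size $k$. Then $G$ has at most $4^k + n$ potential maximal cliques.
   Context: A vertex cover of $G$ is a set $V_k\subseteq V(G)$ such that every edge of $G$ has at least one endpoint in $V_k$. A triangulation of $G$ is a chordal graph $H$ with $V(H)=V(G)$ and $E(G)\subseteq E(H)$; it is minimal if no triangulation of $G$ has an edge set that is a proper subset of $E(H)$. A set $\Omega\subseteq V(G)$ is a potential maximal clique (PMC) of $G$ if $\Omega$ is a maximal clique of some minimal triangulation of $G$. -}

module Defs where

open import Data.Nat using (ℕ; zero; suc; _≤_; _∸_)
open import Data.Bool using (Bool; true; false)
open import Data.Fin using (Fin; toℕ)
open import Data.Fin.Subset using (Subset; _∈_; _∉_; _⊆_; ∣_∣)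
open import Data.Product using (Σ; ∃; _×_; _,_)
open import Data.Sum using (_⊎_)
open import Relation.Nullary using (¬_)
open import Relation.Binary.PropositionalEquality using (_≡_; _≢_)
open import Function.Definitions using (Injective)

record Graph (n : ℕ) : Set where
  field
    adj    : Fin n → Fin n → Bool
    sym    : ∀ u v → adj u v ≡ adj v u
    irrefl : ∀ u → adj u u ≡ false
open Graph public

Edge : ∀ {n} → Graph n → Fin n → Fin n → Set
Edge G u v = adj G u v ≡ true

_⊆E_ : ∀ {n} → Graph n → Graph n → Set
G ⊆E H = ∀ u v → Edge G u v → Edge H u v

IsVertexCover : ∀ {n} → Graph n → Subset n → Set
IsVertexCover G S = ∀ u v → Edge G u v → u ∈ S ⊎ v ∈ S

HasVertexCoverOfSize : ∀ {n} → Graph n → ℕ → Set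
HasVertexCoverOfSize G k = Σ _ λ S → IsVertexCover G S × ∣ S ∣ ≡ k

CycSucc : ∀ {m} → Fin m → Fin m → Set
CycSucc {m} i j = (toℕ j ≡ suc (toℕ i)) ⊎ ((suc (toℕ i) ≡ m) × (toℕ j ≡ 0))

IsCycle : ∀ {n} → Graph n → (m : ℕ) → (Fin m → Fin n) → Set
IsCycle H m c = Injective _≡_ _≡_ c × (∀ i j → CycSucc i j → Edge H (c i) (c j))

HasChord : ∀ {n} → Graph n → (m : ℕ) → (Fin m → Fin n) → Set
HasChord H m c = ∃ λ i → ∃ λ j →
  i ≢ j × ¬ CycSucc i j × ¬ CycSucc j i × Edge H (c i) (c j)

IsChordal : ∀ {n} → Graph n → Set
IsChordal {n} H = ∀ (m : ℕ) (c : Fin m → Fin n) → 4 ≤ m → IsCycle H m c → HasChord H m c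

IsTriangulation : ∀ {n} → Graph n → Graph n → Set
IsTriangulation G H = IsChordal H × (G ⊆E H)

IsMinimalTriangulation : ∀ {n} → Graph n → Graph n → Set
IsMinimalTriangulation G H =
  IsTriangulation G H ×
  (∀ H' → IsTriangulation G H' → H' ⊆E H →
     ¬ (∃ λ u → ∃ λ v → Edge H u v × ¬ Edge H' u v))

IsClique : ∀ {n} → Graph n → Subset n → Set
IsClique H Ω = ∀ u v → u ∈ Ω → v ∈ Ω → u ≢ v → Edge H u v

IsMaximalClique : ∀ {n} → Graph n → Subset n → Set
IsMaximalClique H Ω = IsClique H Ω × (∀ Ω' → IsClique H Ω' → Ω ⊆ Ω' → Ω' ⊆ Ω)

IsPMC : ∀ {n} → Graph n → Subset n → Set
IsPMC G Ω = Σ (Graph _) λ H → IsMinimalTriangulation G H × IsMaximalClique H Ω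

{-# OPTIONS --safe #-}
-- Let W be the vertex cover, Ω a maximal clique of a minimal triangulation of G, and call
-- "components" those of G − Ω. Two facts about Ω are needed: nonadjacent vertices of Ω see a
-- common component, and no component is seen by all of Ω. If some x ∈ Ω ∖ W sees no component,
-- then Ω = N[x]; this accounts for n cliques. Otherwise Ω is recovered from a 4-colouring of W:
--
-- * If some vertex of Ω ∖ W sees a single component C, all of Ω ∖ W sees C. Choose y ∈ Ω not
--   seen by C; then y ∈ W. Colour C red, y blue, the rest of Ω black and everything else green.
--   The vertices of Ω ∖ W are those outside W with a red and a (green or blue) neighbour.
--
-- * If every vertex of Ω ∖ W sees at least two components, the components can be coloured red,
--   green and blue so that each vertex of Ω ∖ W sees two colours; colour Ω black. The vertices
--   outside Ω ∪ W see one colour only. Here red, green and blue may be permuted, so the first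
--   of them to occur may be taken to be red.
--
-- Colourings with exactly one blue vertex and colourings in which red occurs before green and
-- blue number at most 4 ^ k together, although a colouring may be of both kinds.
module Submission where

open import Defs hiding (sym)
open import Data.Bool using (true; false; _∧_)
import Data.Bool as Bool
open import Data.Empty using (⊥)
open import Data.Fin using (Fin; zero; suc; toℕ; fromℕ; inject₁)
import Data.Fin as Fin
open import Data.Fin.Induction using (<-weakInduction; >-weakInduction)
open import Data.Fin.Properties using (any?; sequence; toℕ-injective; toℕ-fromℕ; toℕ-inject₁; toℕ<n; injective⇒≤; suc-injective; 0≢1+n)
open import Data.Fin.Relation.Unary.Top using (view; ‵fromℕ; ‵inject₁)
open import Data.Fin.Subset using (Subset; _∈_; _∉_; _∪_; ⁅_⁆; ∣_∣; inside; outside)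
open import Data.Fin.Subset.Properties using (_∈?_; p⊆p∪q; q⊆p∪q; x∈p∪q⁻; x∈⁅x⁆; x∈⁅y⁆⇒x≡y; p⊂q⇒∣p∣<∣q∣; drop-there; ⊆-antisym)
open import Data.List using (List; []; _∷_; _++_; map; length; lookup; cartesianProductWith; allFin)
open import Data.List.Membership.Propositional using () renaming (_∈_ to _∈ᴸ_)
open import Data.List.Membership.Propositional.Properties using (∈-map⁺; ∈-++⁺ˡ; ∈-++⁺ʳ; ∈-cartesianProductWith⁺; ∈-lookup; ∈-allFin)
open import Data.List.Properties using (length-map; length-++; length-tabulate)
open import Data.List.Relation.Unary.All using (All; []; _∷_)
import Data.List.Relation.Unary.All as All
open import Data.List.Relation.Unary.AllPairs using ([]; _∷_)
open import Data.List.Relation.Unary.Any using (here; there; index)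
open import Data.List.Relation.Unary.Any.Properties using (lookup-index)
open import Data.List.Relation.Unary.Unique.Propositional using (Unique)
open import Data.Nat using (ℕ; zero; suc; _+_; _≤_; _<_; z≤n; s≤s; z<s; _*_; _^_)
open import Data.Nat.Induction using (<-rec)
import Data.Nat.Properties as ℕ
open import Data.Nat.Tactic.RingSolver using (solve-∀)
open import Data.Product using (∃; _×_; _,_; proj₁; proj₂)
open import Data.Sum using (_⊎_; inj₁; inj₂; [_,_])
import Data.Sum as Sum
open import Data.Vec using (tabulate; Vec; []; _∷_; here; there)
import Data.Vec as Vec
open import Data.Vec.Properties using (lookup∘tabulate; lookup⇒[]=; []=⇒lookup)
open import Effect.Monad using (RawMonad)
open import Function using (_∘_; mk⇔; id)
open import Function.Definitions using (Injective)
open import Relation.Binary using (tri<; tri≈; tri>)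
open import Relation.Binary.Construct.Closure.ReflexiveTransitive using (Star; ε; _◅_; _◅◅_; reverse)
open import Relation.Binary.PropositionalEquality using (_≡_; _≢_; refl; sym; trans; cong; subst; ≢-sym; cong₂)
open import Relation.Nullary using (¬_; Dec; yes; no; does; contradiction; ¬?; decidable-stable; _×-dec_; _⊎-dec_)
open import Relation.Nullary.Decidable using (¬¬-excluded-middle; does-⇔; dec-true)
open import Relation.Nullary.Negation using (¬¬-Monad)

-- Classical reasoning under double negation

private
  variable
    n m : ℕ
    A B : Set

-- The final inequality is decidable, so classical reasoning is available up to double negation.
¬¬-∀ : {P : Fin n → Set} → (∀ i → ¬ ¬ P i) → ¬ ¬ (∀ i → P i)
¬¬-∀ = sequence (RawMonad.rawApplicative ¬¬-Monad)

¬¬-decidable : (P : Fin n → Set) → ¬ ¬ (∀ i → Dec (P i))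
¬¬-decidable P = ¬¬-∀ λ i → ¬¬-excluded-middle

¬¬-decidable₂ : (R : Fin n → Fin n → Set) → ¬ ¬ (∀ i j → Dec (R i j))
¬¬-decidable₂ R = ¬¬-∀ λ i → ¬¬-decidable (R i)

-- Well-founded induction on `μ`: once all smaller elements are excluded, `x` is itself minimal.
-- This stands in for choosing a minimal element, which would require deciding `P`.
¬-by-minimal : {A : Set} (μ : A → ℕ) (P : A → Set) →
  (∀ x → P x → ¬ (∀ y → P y → μ x ≤ μ y)) → ∀ x → ¬ P x
¬-by-minimal {A} μ P step x = <-rec (λ k → ∀ x → μ x ≡ k → ¬ P x) body (μ x) x refl
  where
  body : ∀ k → (∀ {j} → j < k → ∀ x → μ x ≡ j → ¬ P x) → ∀ x → μ x ≡ k → ¬ P x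
  body _ ih x refl Px = step x Px λ y Py → ℕ.≮⇒≥ λ lt → ih lt y refl Py

-- Adjacency and deletion of edges

edge-sym : (G : Graph n) {u v : Fin n} → Edge G u v → Edge G v u
edge-sym G {u} {v} e = trans (Graph.sym G v u) e

edge⇒≢ : (G : Graph n) {u v : Fin n} → Edge G u v → u ≢ v
edge⇒≢ G {u} e refl with () ← trans (sym e) (Graph.irrefl G u)

edge? : (G : Graph n) (u v : Fin n) → Dec (Edge G u v)
edge? G u v = adj G u v Bool.≟ true

module _ (H : Graph n) {Q : Fin n → Fin n → Set} (Q? : ∀ a b → Dec (Q a b))
         (Q-sym : ∀ {a b} → Q a b → Q b a) where

  restrict : Graph n
  restrict = record
    { adj    = λ a b → adj H a b ∧ does (Q? a b)
    ; sym    = λ a b → symm a b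
    ; irrefl = λ a → irr a
    }
    where
    symm : ∀ a b → adj H a b ∧ does (Q? a b) ≡ adj H b a ∧ does (Q? b a)
    symm a b rewrite Graph.sym H a b | does-⇔ (mk⇔ Q-sym Q-sym) (Q? a b) (Q? b a) = refl
    irr : ∀ a → adj H a a ∧ does (Q? a a) ≡ false
    irr a rewrite Graph.irrefl H a = refl

  restrict⁻ : ∀ {a b} → Edge restrict a b → Edge H a b × Q a b
  restrict⁻ {a} {b} e with adj H a b | Q? a b
  ... | true | yes q = refl , q

  restrict⁺ : ∀ {a b} → Edge H a b → Q a b → Edge restrict a b
  restrict⁺ {a} {b} e q with adj H a b | Q? a b
  ... | true | yes _ = refl
  ... | true | no ¬q = contradiction q ¬q

-- Cyclic successors, rotation of cycles, and chords from clique separators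

next : Fin (suc m) → Fin (suc m)
next i with view i
... | ‵fromℕ     = zero
... | ‵inject₁ j = suc j

CycSucc⇒next : {i j : Fin (suc m)} → CycSucc i j → j ≡ next i
CycSucc⇒next {m} {i} {j} s with view i | s
... | ‵fromℕ     | inj₁ p       = contradiction (toℕ<n j)
      (ℕ.≤⇒≯ (ℕ.≤-reflexive (sym (trans p (cong suc (toℕ-fromℕ m))))))
... | ‵fromℕ     | inj₂ (_ , p) = toℕ-injective p
... | ‵inject₁ k | inj₁ p       = toℕ-injective (trans p (cong suc (toℕ-inject₁ k)))
... | ‵inject₁ k | inj₂ (p , _) = contradiction
      (trans (sym (toℕ-inject₁ k)) (ℕ.suc-injective p)) (ℕ.<⇒≢ (toℕ<n k))

CycSucc-next : (i : Fin (suc m)) → CycSucc i (next i)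
CycSucc-next {m} i with view i
... | ‵fromℕ     = inj₂ (cong suc (toℕ-fromℕ m) , refl)
... | ‵inject₁ k = inj₁ (cong suc (sym (toℕ-inject₁ k)))

next-injective : Injective _≡_ _≡_ (next {m})
next-injective {m} {i} {j} eq with view i | view j
... | ‵fromℕ     | ‵fromℕ     = refl
... | ‵inject₁ k | ‵inject₁ l with refl ← eq = refl

module _ (K : Graph n) where

  rotate-cycle : {c : Fin (suc m) → Fin n} → IsCycle K (suc m) c → IsCycle K (suc m) (c ∘ next)
  rotate-cycle (inj , edge) = next-injective ∘ inj , λ i j s →
    edge (next i) (next j) (subst (λ k → CycSucc (next i) (next k)) (sym (CycSucc⇒next s)) (CycSucc-next (next i)))

  unrotate-chord : {c : Fin (suc m) → Fin n} → HasChord K (suc m) (c ∘ next) → HasChord K (suc m) c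
  unrotate-chord (i , j , i≢j , ¬ij , ¬ji , e) =
    next i , next j , i≢j ∘ next-injective , ¬ij ∘ reflect i j , ¬ji ∘ reflect j i , e
    where
    reflect : ∀ i j → CycSucc (next i) (next j) → CycSucc i j
    reflect i j s = subst (CycSucc i) (sym (next-injective (CycSucc⇒next s))) (CycSucc-next i)

  -- A cycle through X that also leaves X ∪ N crosses the clique N on both sides.
  separator-chord : (X N : Fin n → Set) →
    (∀ {a b} → X a → Edge K a b → X b ⊎ N b) →
    (∀ {a b} → N a → N b → a ≢ b → Edge K a b) →
    {c : Fin (suc m) → Fin n} → IsCycle K (suc m) c →
    ∀ i j → X (c i) → ¬ X (c j) → ¬ N (c j) → HasChord K (suc m) c
  -- Rotation brings a vertex of `X` to position zero; `j` then splits the rest of the cycle into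
  -- two arcs.
  separator-chord {m} X N leave clique cyc i j = <-weakInduction
      (λ i → ∀ {c} → IsCycle K (suc m) c → ∀ j → X (c i) → ¬ X (c j) → ¬ N (c j) → HasChord K (suc m) c)
      from-zero
      rotated
      i cyc j
    where
    from-zero : ∀ {c} → IsCycle K (suc m) c → ∀ j → X (c zero) → ¬ X (c j) → ¬ N (c j) → HasChord K (suc m) c
    from-zero {c} (inj , edge) j X0 ¬Xj ¬Nj with <-weakInduction Before (inj₁ X0) forward j
                                               | >-weakInduction After last backward j
      where
      -- At `j` these give crossings `p` and `q` of `N` on its two sides. Demanding `0 < toℕ p`
      -- keeps `p` from following `q` around the end of the cycle.
      Before After : Fin (suc m) → Set
      Before i = X (c i) ⊎ ∃ λ p → 0 < toℕ p × toℕ p ≤ toℕ i × N (c p)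
      After  i = X (c i) ⊎ ∃ λ q → toℕ i ≤ toℕ q × N (c q)
      forward : ∀ i → Before (inject₁ i) → Before (suc i)
      forward i (inj₁ Xi) = Sum.map₂ (λ Nsi → suc i , z<s , ℕ.≤-refl , Nsi)
        (leave Xi (edge (inject₁ i) (suc i) (inj₁ (cong suc (sym (toℕ-inject₁ i))))))
      forward i (inj₂ (p , 0<p , p≤i , Np)) =
        inj₂ (p , 0<p , ℕ.≤-trans p≤i (ℕ.≤-trans (ℕ.≤-reflexive (toℕ-inject₁ i)) (ℕ.n≤1+n _)) , Np)
      last : After (fromℕ m)
      last = Sum.map₂ (λ Nl → fromℕ m , ℕ.≤-refl , Nl)
        (leave X0 (edge-sym K (edge (fromℕ m) zero (inj₂ (cong suc (toℕ-fromℕ m) , refl)))))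
      backward : ∀ i → After (suc i) → After (inject₁ i)
      backward i (inj₁ Xsi) = Sum.map₂ (λ Ni → inject₁ i , ℕ.≤-refl , Ni)
        (leave Xsi (edge-sym K (edge (inject₁ i) (suc i) (inj₁ (cong suc (sym (toℕ-inject₁ i)))))))
      backward i (inj₂ (q , i<q , Nq)) =
        inj₂ (q , ℕ.≤-trans (ℕ.≤-reflexive (toℕ-inject₁ i)) (ℕ.≤-trans (ℕ.n≤1+n _) i<q) , Nq)
    ... | inj₁ Xj | _ = contradiction Xj ¬Xj
    ... | inj₂ _ | inj₁ Xj = contradiction Xj ¬Xj
    ... | inj₂ (p , 0<p , p≤j , Np) | inj₂ (q , j≤q , Nq) =
      p , q , p≢q , ¬pq , ¬qp , clique Np Nq (p≢q ∘ inj)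
      where
      p<j : toℕ p < toℕ j
      p<j = ℕ.≤∧≢⇒< p≤j λ eq → ¬Nj (subst (N ∘ c) (toℕ-injective eq) Np)
      j<q : toℕ j < toℕ q
      j<q = ℕ.≤∧≢⇒< j≤q λ eq → ¬Nj (subst (N ∘ c) (sym (toℕ-injective eq)) Nq)
      1+p<q : suc (toℕ p) < toℕ q
      1+p<q = ℕ.≤-<-trans p<j j<q
      p≢q : p ≢ q
      p≢q refl = ℕ.<⇒≱ 1+p<q (ℕ.n≤1+n _)
      ¬pq : ¬ CycSucc p q
      ¬pq (inj₁ eq)       = ℕ.<⇒≢ 1+p<q (sym eq)
      ¬pq (inj₂ (eq , _)) = ℕ.<⇒≱ (ℕ.<-≤-trans 1+p<q (ℕ.<⇒≤ (toℕ<n q))) (ℕ.≤-reflexive (sym eq))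
      ¬qp : ¬ CycSucc q p
      ¬qp (inj₁ eq)       = ℕ.<⇒≱ (ℕ.<-trans p<j j<q) (ℕ.≤-trans (ℕ.n≤1+n _) (ℕ.≤-reflexive (sym eq)))
      ¬qp (inj₂ (_ , eq)) = ℕ.<⇒≢ 0<p (sym eq)
    rotated : ∀ i →
      (∀ {c} → IsCycle K (suc m) c → ∀ j → X (c (inject₁ i)) → ¬ X (c j) → ¬ N (c j) → HasChord K (suc m) c) →
      ∀ {c} → IsCycle K (suc m) c → ∀ j → X (c (suc i)) → ¬ X (c j) → ¬ N (c j) → HasChord K (suc m) c
    rotated i ih {c} cyc j Xi ¬Xj ¬Nj = unrotate-chord (ih (rotate-cycle cyc) (proj₁ j′)
      (subst (X ∘ c) (CycSucc⇒next (inj₁ (cong suc (sym (toℕ-inject₁ i))))) Xi)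
      (subst (λ k → ¬ X (c k)) (sym (proj₂ j′)) ¬Xj) (subst (λ k → ¬ N (c k)) (sym (proj₂ j′)) ¬Nj))
      where
      next-surjective : ∀ j → ∃ λ i → next i ≡ j
      next-surjective zero    = fromℕ m , sym (CycSucc⇒next (inj₂ (cong suc (toℕ-fromℕ m) , refl)))
      next-surjective (suc j) = inject₁ j , sym (CycSucc⇒next (inj₁ (cong suc (sym (toℕ-inject₁ j)))))
      j′ = next-surjective j

-- Components of the graph outside a vertex set

module Component (G : Graph n) (Ω : Subset n) where

  infix 4 _~_

  Step : Fin n → Fin n → Set
  Step u v = u ∉ Ω × v ∉ Ω × Edge G u v

  -- For u ∉ Ω, the vertices v with u ~ v form the component of u in G − Ω.
  _~_ : Fin n → Fin n → Set
  _~_ = Star Step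

  Sees : Fin n → Fin n → Set
  Sees u a = ∃ λ c → u ~ c × Edge G c a

  ~-sym : ∀ {u v} → u ~ v → v ~ u
  ~-sym = reverse λ (u∉ , v∉ , e) → v∉ , u∉ , edge-sym G e

  ~-∉ : ∀ {u v} → u ∉ Ω → u ~ v → v ∉ Ω
  ~-∉ u∉ ε                     = u∉
  ~-∉ _  ((_ , v∉ , _) ◅ rest) = ~-∉ v∉ rest

  edge⇒~ : ∀ {u v} → u ∉ Ω → v ∉ Ω → Edge G u v → u ~ v
  edge⇒~ u∉ v∉ e = (u∉ , v∉ , e) ◅ ε

  Sees-resp : ∀ {u v a} → u ~ v → Sees v a → Sees u a
  Sees-resp u~v (c , v~c , e) = c , u~v ◅◅ v~c , e

  Sees⇒~ : ∀ {u v} → u ∉ Ω → v ∉ Ω → Sees u v → u ~ v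
  Sees⇒~ u∉ v∉ (c , u~c , e) = u~c ◅◅ edge⇒~ (~-∉ u∉ u~c) v∉ e

-- Nonadjacent vertices of the clique see a common component

module _ {G H : Graph n} (minimal : IsMinimalTriangulation G H)
         {Ω : Subset n} (clique : IsClique H Ω) where

  open Component G Ω

  private
    chordal = proj₁ (proj₁ minimal)
    G⊆H = proj₂ (proj₁ minimal)

  -- If no component saw both u and v, one could delete from H the edge uv and all edges
  -- between different components: this leaves a complete graph minus uv on Ω, with the
  -- chordal graphs H[C ∪ N(C)] glued to it along cliques.
  nonadjacent⇒common-component : ∀ {u v} → u ∈ Ω → v ∈ Ω → u ≢ v → ¬ Edge G u v →
    ¬ (∀ w → w ∉ Ω → Sees w u → ¬ Sees w v)
  nonadjacent⇒common-component {u} {v} u∈ v∈ u≢v ¬uv apart =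
    -- Adjacency is Boolean, so deleting edges needs a decision of `Kept`; the negated goal permits
    -- assuming one.
    ¬¬-decidable₂ Touches λ touches? → ¬¬-decidable₂ Kept λ kept? → contra touches? kept?
    where
    -- For `w` outside `Ω` this is membership in C ∪ N(C), where C is the component of `w`.
    Touches : Fin n → Fin n → Set
    Touches w a = w ~ a ⊎ Sees w a

    IsUV : Fin n → Fin n → Set
    IsUV a b = a ≡ u × b ≡ v ⊎ a ≡ v × b ≡ u

    Kept : Fin n → Fin n → Set
    Kept a b = (a ∈ Ω × b ∈ Ω × ¬ IsUV a b) ⊎ ∃ λ w → w ∉ Ω × Touches w a × Touches w b

    kept-sym : ∀ {a b} → Kept a b → Kept b a
    kept-sym (inj₁ (a∈ , b∈ , ¬ab)) = inj₁ (b∈ , a∈ , ¬ab ∘ Sum.swap ∘ Sum.map (λ (p , q) → q , p) (λ (p , q) → q , p))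
    kept-sym (inj₂ (w , w∉ , ta , tb)) = inj₂ (w , w∉ , tb , ta)

    touches⇒~ : ∀ {w a} → w ∉ Ω → a ∉ Ω → Touches w a → w ~ a
    touches⇒~ w∉ a∉ = [ (λ w~a → w~a) , Sees⇒~ w∉ a∉ ]

    touches⇒sees : ∀ {w a} → w ∉ Ω → a ∈ Ω → Touches w a → Sees w a
    touches⇒sees w∉ a∈ = [ (λ w~a → contradiction a∈ (~-∉ w∉ w~a)) , (λ s → s) ]

    touches-resp : ∀ {w w′ a} → w ~ w′ → Touches w′ a → Touches w a
    touches-resp w~w′ = Sum.map (w~w′ ◅◅_) (Sees-resp w~w′)

    module _ (touches? : ∀ w a → Dec (Touches w a)) (kept? : ∀ a b → Dec (Kept a b)) where

      H′ : Graph n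
      H′ = restrict H kept? kept-sym

      H′⁻ : ∀ {a b} → Edge H′ a b → Edge H a b × Kept a b
      H′⁻ = restrict⁻ H kept? kept-sym

      H′⁺ : ∀ {a b} → Edge H a b → Kept a b → Edge H′ a b
      H′⁺ = restrict⁺ H kept? kept-sym

      G⊆H′ : G ⊆E H′
      G⊆H′ a b e = H′⁺ (G⊆H a b e) kept
        where
        kept : Kept a b
        kept with a ∈? Ω | b ∈? Ω
        ... | no a∉  | _      = inj₂ (a , a∉ , inj₁ ε , inj₂ (a , ε , e))
        ... | yes _  | no b∉  = inj₂ (b , b∉ , inj₂ (b , ε , edge-sym G e) , inj₁ ε)
        ... | yes a∈ | yes b∈ = inj₁ (a∈ , b∈ , λ where
          (inj₁ (refl , refl)) → ¬uv e
          (inj₂ (refl , refl)) → ¬uv (edge-sym G e))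

      ¬H′uv : ¬ Edge H′ u v
      ¬H′uv e with proj₂ (H′⁻ e)
      ... | inj₁ (_ , _ , ¬IsUV)      = ¬IsUV (inj₁ (refl , refl))
      ... | inj₂ (w , w∉ , tu , tv) = apart w w∉ (touches⇒sees w∉ u∈ tu) (touches⇒sees w∉ v∈ tv)

      -- The diagonals 02 and 13 of the first four vertices are disjoint pairs, so at most one of
      -- them is uv; the other is kept.
      Ω-chord : ∀ {m c} → 4 ≤ m → IsCycle H′ m c → (∀ i → c i ∈ Ω) → HasChord H′ m c
      Ω-chord {c = c} (s≤s (s≤s (s≤s (s≤s {n = m} _)))) (inj , _) c∈ = chord
        where
        0F 1F 2F 3F : Fin (4 + m)
        0F = zero
        1F = suc zero
        2F = suc (suc zero)
        3F = suc (suc (suc zero))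
        edge : ∀ i j → i ≢ j → ¬ IsUV (c i) (c j) → Edge H′ (c i) (c j)
        edge i j i≢j ¬IsUV =
          H′⁺ (clique (c i) (c j) (c∈ i) (c∈ j) (i≢j ∘ inj)) (inj₁ (c∈ i , c∈ j , ¬IsUV))
        isUV? : ∀ a b → Dec (IsUV a b)
        isUV? a b = (a Fin.≟ u ×-dec b Fin.≟ v) ⊎-dec (a Fin.≟ v ×-dec b Fin.≟ u)
        chord : HasChord H′ (4 + m) c
        chord with isUV? (c 0F) (c 2F) | isUV? (c 1F) (c 3F)
        ... | no ¬02 | _ = 0F , 2F , (λ ()) , (λ where (inj₁ ()); (inj₂ ())) ,
              (λ where (inj₁ ()); (inj₂ ())) , edge 0F 2F (λ ()) ¬02
        ... | yes _ | no ¬13 = 1F , 3F , (λ ()) , (λ where (inj₁ ()); (inj₂ ())) ,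
              (λ where (inj₁ ()); (inj₂ (_ , ()))) , edge 1F 3F (λ ()) ¬13
        ... | yes (inj₁ (p , _)) | yes (inj₁ (q , _)) with () ← inj (trans p (sym q))
        ... | yes (inj₁ (p , _)) | yes (inj₂ (_ , q)) with () ← inj (trans p (sym q))
        ... | yes (inj₂ (p , _)) | yes (inj₁ (_ , q)) with () ← inj (trans p (sym q))
        ... | yes (inj₂ (p , _)) | yes (inj₂ (q , _)) with () ← inj (trans p (sym q))

      -- If some `c i` is outside `Ω`, let C be its component. A cycle leaving C ∪ N(C) has a chord
      -- inside the clique N(C); otherwise any chord in `H` joins two vertices of C ∪ N(C) and is
      -- kept.
      chordal′ : IsChordal H′
      chordal′ m c 4≤m cyc with any? (λ i → ¬? (c i ∈? Ω))
      ... | no none = Ω-chord 4≤m cyc λ i → decidable-stable (c i ∈? Ω) λ ci∉ → none (i , ci∉)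
      chordal′ m@(suc _) c 4≤m cyc@(inj , edge) | yes (i , ci∉) with any? (λ j → ¬? (touches? (c i) (c j)))
      ... | yes (j , ¬tj) =
        separator-chord H′ (c i ~_) (λ a → a ∈ Ω × Sees (c i) a) leave cut-clique cyc i j ε
          (¬tj ∘ inj₁) (¬tj ∘ inj₂ ∘ proj₂)
        where
        leave : ∀ {a b} → c i ~ a → Edge H′ a b → (c i ~ b) ⊎ (b ∈ Ω × Sees (c i) b)
        leave {a} {b} i~a e with proj₂ (H′⁻ e)
        ... | inj₁ (a∈ , _) = contradiction a∈ (~-∉ ci∉ i~a)
        ... | inj₂ (w , w∉ , ta , tb)
          with touches-resp (i~a ◅◅ ~-sym (touches⇒~ w∉ (~-∉ ci∉ i~a) ta)) tb | b ∈? Ω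
        ... | ti | yes b∈ = inj₂ (b∈ , touches⇒sees ci∉ b∈ ti)
        ... | ti | no b∉  = inj₁ (touches⇒~ ci∉ b∉ ti)
        cut-clique : ∀ {a b} → a ∈ Ω × Sees (c i) a → b ∈ Ω × Sees (c i) b → a ≢ b → Edge H′ a b
        cut-clique {a} {b} (a∈ , sa) (b∈ , sb) a≢b =
          H′⁺ (clique a b a∈ b∈ a≢b) (inj₂ (c i , ci∉ , inj₂ sa , inj₂ sb))
      ... | no all-touch
        with p , q , p≢q , ¬pq , ¬qp , e ← chordal m c 4≤m (inj , λ a b s → proj₁ (H′⁻ (edge a b s))) =
        p , q , p≢q , ¬pq , ¬qp , H′⁺ e (inj₂ (c i , ci∉ , touch p , touch q))
        where
        touch : ∀ j → Touches (c i) (c j)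
        touch j = decidable-stable (touches? (c i) (c j)) λ ¬tj → all-touch (j , ¬tj)

      contra : ⊥
      contra = proj₂ minimal H′ (chordal′ , G⊆H′) (λ a b → proj₁ ∘ H′⁻)
        (u , v , clique u v u∈ v∈ u≢v , ¬H′uv)

-- Sizes of decidable subsets

⟦_⟧ : {P : Fin n → Set} → (∀ i → Dec (P i)) → Subset n
⟦ P? ⟧ = tabulate (does ∘ P?)

∈⟦⟧⁺ : {P : Fin n → Set} (P? : ∀ i → Dec (P i)) {i : Fin n} → P i → i ∈ ⟦ P? ⟧
∈⟦⟧⁺ P? {i} p = lookup⇒[]= i _ (trans (lookup∘tabulate (does ∘ P?) i) (dec-true (P? i) p))

∈⟦⟧⁻ : {P : Fin n → Set} (P? : ∀ i → Dec (P i)) {i : Fin n} → i ∈ ⟦ P? ⟧ → P i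
∈⟦⟧⁻ P? {i} i∈ with P? i | trans (sym (lookup∘tabulate (does ∘ P?) i)) ([]=⇒lookup i∈)
... | yes p | _ = p

∣⟦⟧∣-< : {P Q : Fin n → Set} (P? : ∀ i → Dec (P i)) (Q? : ∀ i → Dec (Q i)) →
  (∀ {i} → P i → Q i) → ∀ {x} → Q x → ¬ P x → ∣ ⟦ P? ⟧ ∣ < ∣ ⟦ Q? ⟧ ∣
∣⟦⟧∣-< P? Q? P⇒Q Qx ¬Px =
  p⊂q⇒∣p∣<∣q∣ (∈⟦⟧⁺ Q? ∘ P⇒Q ∘ ∈⟦⟧⁻ P? , _ , ∈⟦⟧⁺ Q? Qx , ¬Px ∘ ∈⟦⟧⁻ P?)

-- Geodesics in a chordal graph

module Geodesics (H : Graph n) (C : Fin n → Set) (z : Fin n) where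

  data Walk : ℕ → Fin n → Set where
    stop : Walk 0 z
    step : ∀ {k u v} → C u → Edge H u v → Walk k v → Walk (suc k) u

  Geodesic : ℕ → Fin n → Set
  Geodesic k u = Walk k u × (∀ {j} → Walk j u → k ≤ j)

  geodesic-unique : ∀ {i j u} → Geodesic i u → Geodesic j u → i ≡ j
  geodesic-unique (p , p-min) (q , q-min) = ℕ.≤-antisym (p-min q) (q-min p)

  -- Prefixing `u` to a geodesic from `v` gives a walk of length `suc j`. This needs `C u`, which
  -- only the walk `stop` of length 0 fails to provide.
  geodesic-adjacent : ∀ {i j u v} → Geodesic i u → Geodesic j v → Edge H u v → i ≤ suc j
  geodesic-adjacent (stop , _)          _       _ = z≤n
  geodesic-adjacent (step cu _ _ , min) (q , _) e = min (step cu e q)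

  -- The vertices of a geodesic, indexed by their distance to z.
  geodesic-vertices : ∀ k {u} → Geodesic k u → ∃ λ (r : ℕ → Fin n) →
    r k ≡ u × (∀ {i} → i ≤ k → Geodesic i (r i)) × (∀ {i} → i < k → Edge H (r i) (r (suc i)))
  geodesic-vertices zero    {u} g = (λ _ → u) , refl , (λ where z≤n → g) , λ ()
  geodesic-vertices (suc k) {u} g@(step {v = v} cu e w , min)
    with r , rk , geo , edge ← geodesic-vertices k (w , λ w′ → ℕ.≤-pred (min (step cu e w′)))
    = r′ , r′-top , geo′ , edge′
    where
    r′ : ℕ → Fin n
    r′ i with i ℕ.≟ suc k
    ... | yes _ = u
    ... | no  _ = r i
    r′-top : r′ (suc k) ≡ u
    r′-top with suc k ℕ.≟ suc k
    ... | yes _ = refl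
    ... | no ¬p = contradiction refl ¬p
    geo′ : ∀ {i} → i ≤ suc k → Geodesic i (r′ i)
    geo′ {i} i≤ with i ℕ.≟ suc k
    ... | yes refl = g
    ... | no  i≢   = geo (ℕ.≤-pred (ℕ.≤∧≢⇒< i≤ i≢))
    edge′ : ∀ {i} → i < suc k → Edge H (r′ i) (r′ (suc i))
    edge′ {i} i< with i ℕ.≟ suc k | suc i ℕ.≟ suc k
    ... | yes refl | _        = contradiction i< (ℕ.<-irrefl refl)
    ... | no _     | yes refl = subst (λ x → Edge H x u) (sym rk) (edge-sym H e)
    ... | no _     | no i≢    = edge (ℕ.≤∧≢⇒< (ℕ.≤-pred i<) (i≢ ∘ cong suc))

  module _ (chordal : IsChordal H) {k : ℕ} {r : ℕ → Fin n}
           (geo : ∀ {i} → i ≤ k → Geodesic i (r i))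
           (edge : ∀ {i} → i < k → Edge H (r i) (r (suc i)))
           {w : Fin n} (w∉C : ¬ C w) (wz : Edge H w z) where

    private
      -- Otherwise w, r 0, …, r i is a chordless cycle for the least i ≥ 1 with w adjacent to r i.
      no-chordless-cycle : ¬ Edge H w (r 1) → ∀ i → ¬ (1 ≤ i × i ≤ k × Edge H w (r i))
      no-chordless-cycle ¬w1 = ¬-by-minimal id _ body
        where
        body : ∀ i → 1 ≤ i × i ≤ k × Edge H w (r i) →
          ¬ (∀ j → 1 ≤ j × j ≤ k × Edge H w (r j) → i ≤ j)
        body (suc zero) (_ , _ , w1) _ = ¬w1 w1
        body i@(suc (suc i″)) (_ , i≤k , wi) min = no-chord (chordal (2 + i) c (s≤s (s≤s (s≤s (s≤s z≤n)))) (c-inj , c-edge))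
          where
          c : Fin (2 + i) → Fin n
          c zero    = w
          c (suc a) = r (toℕ a)

          geo-at : (a : Fin (suc i)) → Geodesic (toℕ a) (r (toℕ a))
          geo-at a = geo (ℕ.≤-trans (ℕ.≤-pred (toℕ<n a)) i≤k)

          r0≡z : ∀ {j} → Walk 0 j → j ≡ z
          r0≡z stop = refl

          w≢r : (a : Fin (suc i)) → w ≢ r (toℕ a)
          w≢r a eq with toℕ a | geo-at a
          ... | zero  | stop , _        = edge⇒≢ H wz eq
          ... | suc _ | step cu _ _ , _ = w∉C (subst C (sym eq) cu)

          c-inj : Injective _≡_ _≡_ c
          c-inj {zero}  {zero}  _  = refl
          c-inj {zero}  {suc b} eq = contradiction eq (w≢r b)
          c-inj {suc a} {zero}  eq = contradiction (sym eq) (w≢r a)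
          c-inj {suc a} {suc b} eq =
            cong suc (toℕ-injective (geodesic-unique (geo-at a) (subst (Geodesic _) (sym eq) (geo-at b))))

          c-edge : ∀ a b → CycSucc a b → Edge H (c a) (c b)
          c-edge zero    zero    (inj₁ ())
          c-edge zero    zero    (inj₂ (() , _))
          c-edge zero    (suc b) (inj₁ eq) rewrite ℕ.suc-injective eq = subst (Edge H w) (sym (r0≡z (proj₁ (geo z≤n)))) wz
          c-edge zero    (suc b) (inj₂ (_ , ()))
          c-edge (suc a) zero    (inj₂ (eq , _))
            rewrite ℕ.suc-injective (ℕ.suc-injective eq) = edge-sym H wi
          c-edge (suc a) (suc b) (inj₁ eq)
            rewrite ℕ.suc-injective eq =
            edge (ℕ.<-≤-trans (ℕ.<-≤-trans (ℕ.≤-reflexive (sym (ℕ.suc-injective eq))) (ℕ.≤-pred (toℕ<n b))) i≤k)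

          -- `r 0` and `r i` are the neighbours of `w` on the cycle; a chord to a vertex strictly
          -- between them contradicts the minimality of `i`.
          chord-at-w : ∀ b → ¬ CycSucc {2 + i} zero (suc b) → ¬ CycSucc {2 + i} (suc b) zero → ¬ Edge H w (r (toℕ b))
          chord-at-w b ¬0b ¬b0 e with toℕ b | ℕ.≤-pred (toℕ<n b)
          ... | zero  | _   = ¬0b (inj₁ refl)
          ... | suc j | j<i = ¬b0 (inj₂ (cong (2 +_)
                (ℕ.≤-antisym j<i (min (suc j) (s≤s z≤n , ℕ.≤-trans j<i i≤k , e))) , refl))

          no-chord : ¬ HasChord H (2 + i) c
          no-chord (zero  , zero  , a≢b , _)               = a≢b refl
          no-chord (zero  , suc b , _ , ¬ab , ¬ba , e)     = chord-at-w b ¬ab ¬ba e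
          no-chord (suc a , zero  , _ , ¬ab , ¬ba , e)     = chord-at-w a ¬ba ¬ab (edge-sym H e)
          -- Adjacent vertices have distances to `z` differing by at most one, so such a chord would
          -- join consecutive vertices of the geodesic.
          no-chord (suc a , suc b , a≢b , ¬ab , ¬ba , e) with ℕ.<-cmp (toℕ a) (toℕ b)
          ... | tri≈ _ eq _ = a≢b (cong suc (toℕ-injective eq))
          ... | tri< lt _ _ = ¬ab (inj₁ (cong suc (ℕ.≤-antisym (geodesic-adjacent (geo-at b) (geo-at a) (edge-sym H e)) lt)))
          ... | tri> _ _ gt = ¬ba (inj₁ (cong suc (ℕ.≤-antisym (geodesic-adjacent (geo-at a) (geo-at b) e) gt)))

    -- `r 1` is the vertex before `z` on the geodesic. If `w` were adjacent to both ends but not to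
    -- `r 1`, then `w` and part of the geodesic would form a chordless cycle.
    adjacent-to-penultimate : 1 ≤ k → Edge H w (r k) → Edge H w (r 1)
    adjacent-to-penultimate 1≤k wk = decidable-stable (edge? H w (r 1))
      λ ¬w1 → no-chordless-cycle ¬w1 k (1≤k , ℕ.≤-refl , wk)

-- No component is seen by all of a maximal clique

-- Among the vertices of the component, one with the most H-neighbours in Ω would see all of
-- Ω: a geodesic from it to a missed vertex z ends in a vertex that keeps its
-- neighbours in Ω and gains z.
no-full-component : {G H : Graph n} → IsTriangulation G H → {Ω : Subset n} → IsMaximalClique H Ω →
  ∀ {u} → u ∉ Ω → ¬ (∀ z → z ∈ Ω → Component.Sees G Ω u z)
no-full-component {G = G} {H} (chordal , G⊆H) {Ω} (clique , maximal) {u} u∉ full =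
  ¬-by-minimal missed (u ~_) body u ε
  where
  open Component G Ω

  missing? : ∀ x z → Dec (z ∈ Ω × ¬ Edge H x z)
  missing? x z = (z ∈? Ω) ×-dec ¬? (edge? H x z)

  missed : Fin _ → ℕ
  missed x = ∣ ⟦ missing? x ⟧ ∣

  body : ∀ x → u ~ x → ¬ (∀ y → u ~ y → missed x ≤ missed y)
  body x u~x min with any? (missing? x)
  -- A vertex adjacent to all of `Ω` could be added to it, against maximality.
  ... | no none = ~-∉ u∉ u~x (maximal (Ω ∪ ⁅ x ⁆) extended (p⊆p∪q ⁅ x ⁆) (q⊆p∪q Ω ⁅ x ⁆ (x∈⁅x⁆ x)))
    where
    x-adjacent : ∀ {z} → z ∈ Ω → Edge H x z
    x-adjacent {z} z∈ = decidable-stable (edge? H x z) λ ¬xz → none (z , z∈ , ¬xz)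
    extended : IsClique H (Ω ∪ ⁅ x ⁆)
    extended a b a∈ b∈ a≢b with x∈p∪q⁻ Ω ⁅ x ⁆ a∈ | x∈p∪q⁻ Ω ⁅ x ⁆ b∈
    ... | inj₁ a∈Ω | inj₁ b∈Ω = clique a b a∈Ω b∈Ω a≢b
    ... | inj₁ a∈Ω | inj₂ b∈x rewrite x∈⁅y⁆⇒x≡y x b∈x = edge-sym H (x-adjacent a∈Ω)
    ... | inj₂ a∈x | inj₁ b∈Ω rewrite x∈⁅y⁆⇒x≡y x a∈x = x-adjacent b∈Ω
    ... | inj₂ a∈x | inj₂ b∈x =
      contradiction (trans (x∈⁅y⁆⇒x≡y x a∈x) (sym (x∈⁅y⁆⇒x≡y x b∈x))) a≢b
  ... | yes (z , z∈ , ¬xz) =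
    -- The component sees `z`, so walks from `x` to `z` through it exist; a shortest one is taken.
    ¬-by-minimal id (λ k → Walk k x)
      (λ k w k-min → from-geodesic k (w , k-min _)) (proj₁ some-walk) (proj₂ some-walk)
    where
    open Geodesics H (u ~_) z

    walk : ∀ {y c} → u ~ y → y ~ c → Edge G c z → ∃ λ k → Walk k y
    walk u~y ε e = 1 , step u~y (G⊆H _ _ e) stop
    walk u~y (s@(_ , _ , yv) ◅ rest) e with k , w ← walk (u~y ◅◅ s ◅ ε) rest e =
      suc k , step u~y (G⊆H _ _ yv) w

    some-walk : ∃ λ k → Walk k x
    some-walk with c , u~c , e ← full z z∈ = walk u~x (~-sym u~x ◅◅ u~c) e

    from-geodesic : ∀ k → ¬ Geodesic k x
    from-geodesic zero    (stop , _) = ~-∉ u∉ u~x z∈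
    from-geodesic (suc k) g
      with r , rk , geo , edge ← geodesic-vertices (suc k) g
      with r 1 in r1 | geo (s≤s z≤n)
    ... | y | step u~y yz stop , _ = ℕ.<⇒≱ (∣⟦⟧∣-< (missing? y) (missing? x) kept (z∈ , ¬xz) (λ (_ , ¬yz) → ¬yz yz)) (min y u~y)
      where
      kept : ∀ {w} → w ∈ Ω × ¬ Edge H y w → w ∈ Ω × ¬ Edge H x w
      kept {w} (w∈ , ¬yw) = w∈ , λ xw → ¬yw (edge-sym H (subst (Edge H w) r1
        (adjacent-to-penultimate chordal geo edge (λ u~w → ~-∉ u∉ u~w w∈)
          (clique w z w∈ z∈ λ { refl → ¬xz xw }) (s≤s z≤n)
          (subst (Edge H w) (sym rk) (edge-sym H xw)))))

-- Counting by means of codes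

lookup-injective : {xs : List A} → Unique xs → ∀ i j → lookup xs i ≡ lookup xs j → i ≡ j
lookup-injective (_ ∷ _)  zero    zero    _  = refl
lookup-injective (x∉ ∷ _) zero    (suc j) eq = contradiction eq (All.lookup x∉ (∈-lookup j))
lookup-injective (x∉ ∷ _) (suc i) zero    eq = contradiction (sym eq) (All.lookup x∉ (∈-lookup i))
lookup-injective (_ ∷ u)  (suc i) (suc j) eq = cong suc (lookup-injective u i j eq)

-- Sending each entry of `xs` to the position of one of its codes in `bs` is injective. Codes need
-- only exist up to double negation, since the inequality is decidable; hence a relation in place of
-- an encoding function.
length-≤-of-codes : (_codes_ : B → A → Set) → (∀ {b a a′} → b codes a → b codes a′ → a ≡ a′) →
  {xs : List A} {bs : List B} → Unique xs →
  (∀ {a} → a ∈ᴸ xs → ¬ ¬ ∃ λ b → b ∈ᴸ bs × b codes a) → length xs ≤ length bs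
length-≤-of-codes _codes_ det {xs} {bs} unique coded = decidable-stable (_ ℕ.≤? _) λ ¬le →
  ¬¬-∀ (λ i → coded (∈-lookup i)) λ code → ¬le (injective⇒≤ (position-injective code))
  where
  module _ (code : ∀ i → ∃ λ b → b ∈ᴸ bs × b codes lookup xs i) where
    position : Fin (length xs) → Fin (length bs)
    position i = index (proj₁ (proj₂ (code i)))
    position-injective : Injective _≡_ _≡_ position
    position-injective {i} {j} eq with code i | code j
    ... | b , b∈ , bi | b′ , b′∈ , b′j = lookup-injective unique i j (det bi (subst (_codes _)
      (trans (lookup-index b′∈) (trans (cong (lookup bs) (sym eq)) (sym (lookup-index b∈)))) b′j))

length-cartesianProductWith : {C : Set} (f : A → B → C) (xs : List A) (ys : List B) →
  length (cartesianProductWith f xs ys) ≡ length xs * length ys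
length-cartesianProductWith f []       ys = refl
length-cartesianProductWith f (x ∷ xs) ys = trans (length-++ (map (f x) ys))
  (cong₂ _+_ (length-map (f x) ys) (length-cartesianProductWith f xs ys))

-- Lists of colourings and their lengths

data Colour : Set where
  black red green blue : Colour

_≟ᶜ_ : (a b : Colour) → Dec (a ≡ b)
black ≟ᶜ black = yes refl
black ≟ᶜ red   = no λ ()
black ≟ᶜ green = no λ ()
black ≟ᶜ blue  = no λ ()
red   ≟ᶜ black = no λ ()
red   ≟ᶜ red   = yes refl
red   ≟ᶜ green = no λ ()
red   ≟ᶜ blue  = no λ ()
green ≟ᶜ black = no λ ()
green ≟ᶜ red   = no λ ()
green ≟ᶜ green = yes refl
green ≟ᶜ blue  = no λ ()
blue  ≟ᶜ black = no λ ()
blue  ≟ᶜ red   = no λ ()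
blue  ≟ᶜ green = no λ ()
blue  ≟ᶜ blue  = yes refl

-- Each vector covers all `n` vertices and is black off the given set, which avoids reindexing that
-- set.
colourings : List Colour → Subset n → List (Vec Colour n)
colourings cs []            = [] ∷ []
colourings cs (outside ∷ S) = map (black ∷_) (colourings cs S)
colourings cs (inside  ∷ S) = cartesianProductWith _∷_ cs (colourings cs S)

all-colours nonblue : List Colour
all-colours = black ∷ red ∷ green ∷ blue ∷ []
nonblue     = black ∷ red ∷ green ∷ []

redFirst : Subset n → List (Vec Colour n)
redFirst []            = [] ∷ []
redFirst (outside ∷ S) = map (black ∷_) (redFirst S)
redFirst (inside  ∷ S) = map (black ∷_) (redFirst S) ++ map (red ∷_) (colourings all-colours S)

oneBlue : Subset n → List (Vec Colour n)
oneBlue []            = []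
oneBlue (outside ∷ S) = map (black ∷_) (oneBlue S)
oneBlue (inside  ∷ S) = map (blue ∷_) (colourings nonblue S) ++ cartesianProductWith _∷_ nonblue (oneBlue S)

length-colourings : ∀ cs (S : Subset n) → length (colourings cs S) ≡ length cs ^ ∣ S ∣
length-colourings cs []            = refl
length-colourings cs (outside ∷ S) = trans (length-map _ (colourings cs S)) (length-colourings cs S)
length-colourings cs (inside ∷ S)  = trans (length-cartesianProductWith _∷_ cs (colourings cs S))
  (cong (length cs *_) (length-colourings cs S))

length-oneBlue-inside : (S : Subset n) →
  length (oneBlue (inside ∷ S)) ≡ 3 ^ ∣ S ∣ + 3 * length (oneBlue S)
length-oneBlue-inside S = trans (length-++ (map (blue ∷_) (colourings nonblue S)))
  (cong₂ _+_ (trans (length-map _ (colourings nonblue S)) (length-colourings nonblue S))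
             (length-cartesianProductWith _∷_ nonblue (oneBlue S)))

length-redFirst-inside : (S : Subset n) →
  length (redFirst (inside ∷ S)) ≡ length (redFirst S) + 4 ^ ∣ S ∣
length-redFirst-inside S = trans (length-++ (map (black ∷_) (redFirst S)))
  (cong₂ _+_ (length-map _ (redFirst S))
             (trans (length-map _ (colourings all-colours S)) (length-colourings all-colours S)))

length-oneBlue-outside : (S : Subset n) → length (oneBlue (outside ∷ S)) ≡ length (oneBlue S)
length-oneBlue-outside S = length-map _ (oneBlue S)

length-redFirst-outside : (S : Subset n) → length (redFirst (outside ∷ S)) ≡ length (redFirst S)
length-redFirst-outside S = length-map _ (redFirst S)

-- The left side counts the colourings of `S` with at most one blue vertex, which are among all
-- colourings. The induction step of `redFirst-or-oneBlue≤` rests on this.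
nonblue-or-oneBlue≤ : (S : Subset n) → 3 ^ ∣ S ∣ + length (oneBlue S) ≤ 4 ^ ∣ S ∣
nonblue-or-oneBlue≤ []            = ℕ.≤-refl
nonblue-or-oneBlue≤ (outside ∷ S) rewrite length-oneBlue-outside S = nonblue-or-oneBlue≤ S
nonblue-or-oneBlue≤ (inside ∷ S)  rewrite length-oneBlue-inside S = begin
  3 * a + (a + 3 * b)  ≡⟨ regroup a b ⟩
  4 * a + 3 * b        ≤⟨ ℕ.+-monoʳ-≤ (4 * a) (ℕ.*-monoˡ-≤ b (ℕ.n≤1+n 3)) ⟩
  4 * a + 4 * b        ≡⟨ ℕ.*-distribˡ-+ 4 a b ⟨
  4 * (a + b)          ≤⟨ ℕ.*-monoʳ-≤ 4 (nonblue-or-oneBlue≤ S) ⟩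
  4 * 4 ^ ∣ S ∣        ∎
  where
  open ℕ.≤-Reasoning
  a b : ℕ
  a = 3 ^ ∣ S ∣
  b = length (oneBlue S)
  regroup : ∀ a b → 3 * a + (a + 3 * b) ≡ 4 * a + 3 * b
  regroup = solve-∀

-- A new vertex of `S` turns g + b into (g + q) + (t + 3b), where q and t are the powers of 4 and 3.
-- Regrouped as (g + b) + (t + b) + b + q, each of the four summands is at most q.
redFirst-or-oneBlue≤ : (S : Subset n) → length (redFirst S) + length (oneBlue S) ≤ 4 ^ ∣ S ∣
redFirst-or-oneBlue≤ []            = ℕ.≤-refl
redFirst-or-oneBlue≤ (outside ∷ S)
  rewrite length-redFirst-outside S | length-oneBlue-outside S = redFirst-or-oneBlue≤ S
redFirst-or-oneBlue≤ (inside ∷ S)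
  rewrite length-redFirst-inside S | length-oneBlue-inside S = begin
  g + q + (t + 3 * b)                ≡⟨ regroup g q t b ⟩
  (g + b) + (t + b) + b + q          ≤⟨ ℕ.+-monoˡ-≤ q (ℕ.+-mono-≤ (ℕ.+-mono-≤ (redFirst-or-oneBlue≤ S) (nonblue-or-oneBlue≤ S))
                                          (ℕ.≤-trans (ℕ.m≤n+m b t) (nonblue-or-oneBlue≤ S))) ⟩
  q + q + q + q                      ≡⟨ fourfold q ⟩
  4 * q                              ∎
  where
  open ℕ.≤-Reasoning
  g b t q : ℕ
  g = length (redFirst S)
  b = length (oneBlue S)
  t = 3 ^ ∣ S ∣
  q = 4 ^ ∣ S ∣
  regroup : ∀ g q t b → g + q + (t + 3 * b) ≡ (g + b) + (t + b) + b + q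
  regroup = solve-∀
  fourfold : ∀ q → q + q + q + q ≡ 4 * q
  fourfold = solve-∀

-- Completeness of the lists of colourings

BlackOutside : Subset n → (Fin n → Colour) → Set
BlackOutside S f = ∀ {i} → i ∉ S → f i ≡ black

black-tail : ∀ {s} {S : Subset n} {f : Fin (suc n) → Colour} →
  BlackOutside (s ∷ S) f → BlackOutside S (f ∘ suc)
black-tail bo i∉ = bo (i∉ ∘ drop-there)

colourings-complete : ∀ {cs} (S : Subset n) {f : Fin n → Colour} → BlackOutside S f →
  (∀ i → f i ∈ᴸ cs) → tabulate f ∈ᴸ colourings cs S
colourings-complete []            _  _   = here refl
colourings-complete (outside ∷ S) {f} bo f∈
  rewrite bo {zero} (λ ()) = ∈-map⁺ (black ∷_) (colourings-complete S (black-tail bo) (f∈ ∘ suc))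
colourings-complete (inside ∷ S)  bo f∈ =
  ∈-cartesianProductWith⁺ _∷_ (f∈ zero) (colourings-complete S (black-tail bo) (f∈ ∘ suc))

∈-all-colours : ∀ c → c ∈ᴸ all-colours
∈-all-colours black = here refl
∈-all-colours red   = there (here refl)
∈-all-colours green = there (there (here refl))
∈-all-colours blue  = there (there (there (here refl)))

∈-nonblue : ∀ {c} → c ≢ blue → c ∈ᴸ nonblue
∈-nonblue {black} _ = here refl
∈-nonblue {red}   _ = there (here refl)
∈-nonblue {green} _ = there (there (here refl))
∈-nonblue {blue}  ¬ = contradiction refl ¬

oneBlue-complete : (S : Subset n) {f : Fin n → Colour} → BlackOutside S f → ∀ {y} → y ∈ S → f y ≡ blue →
  (∀ {i} → f i ≡ blue → i ≡ y) → tabulate f ∈ᴸ oneBlue S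
oneBlue-complete (outside ∷ S) bo (there y∈) fy only
  rewrite bo {zero} (λ ()) = ∈-map⁺ (black ∷_) (oneBlue-complete S (black-tail bo) y∈ fy (λ eq → suc-injective (only eq)))
oneBlue-complete (inside ∷ S) bo here fy only
  rewrite fy = ∈-++⁺ˡ (∈-map⁺ (blue ∷_) (colourings-complete S (black-tail bo) λ i → ∈-nonblue λ eq → 0≢1+n (sym (only eq))))
oneBlue-complete (inside ∷ S) bo (there y∈) fy only =
  ∈-++⁺ʳ (map (blue ∷_) (colourings nonblue S)) (∈-cartesianProductWith⁺ _∷_ (∈-nonblue λ eq → 0≢1+n (only eq))
    (oneBlue-complete S (black-tail bo) y∈ fy (λ eq → suc-injective (only eq))))

-- The transposition of red and the first argument, except that `swapRed black` is the identity, so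
-- that black is always fixed.
swapRed : Colour → Colour → Colour
swapRed blue  red   = blue
swapRed blue  blue  = red
swapRed green red   = green
swapRed green green = red
swapRed _     c     = c

swapRed-involutive : ∀ e c → swapRed e (swapRed e c) ≡ c
swapRed-involutive black c = refl
swapRed-involutive red   c = refl
swapRed-involutive green black = refl
swapRed-involutive green red = refl
swapRed-involutive green green = refl
swapRed-involutive green blue = refl
swapRed-involutive blue black = refl
swapRed-involutive blue red = refl
swapRed-involutive blue green = refl
swapRed-involutive blue blue = refl

swapRed-injective : ∀ e → Injective _≡_ _≡_ (swapRed e)
swapRed-injective e {a} {b} eq =
  trans (sym (swapRed-involutive e a)) (trans (cong (swapRed e) eq) (swapRed-involutive e b))

swapRed-black : ∀ e → swapRed e black ≡ black
swapRed-black black = refl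
swapRed-black red   = refl
swapRed-black green = refl
swapRed-black blue  = refl

swapRed-self : ∀ {e} → e ≢ black → swapRed e e ≡ red
swapRed-self {black} e≢ = contradiction refl e≢
swapRed-self {red}   _  = refl
swapRed-self {green} _  = refl
swapRed-self {blue}  _  = refl

-- `e` is the colour of the first nonblack vertex, which a single transposition makes red; if all
-- vertices are black, `e` is black.
redFirst-complete : (S : Subset n) {f : Fin n → Colour} → BlackOutside S f →
  ∃ λ e → tabulate (swapRed e ∘ f) ∈ᴸ redFirst S
redFirst-complete []            _  = black , here refl
redFirst-complete (outside ∷ S) {f} bo with e , e∈ ← redFirst-complete S (black-tail bo)
  = e , subst (λ c → c ∷ tabulate (swapRed e ∘ f ∘ suc) ∈ᴸ redFirst (outside ∷ S))
          (sym (trans (cong (swapRed e) (bo λ ())) (swapRed-black e))) (∈-map⁺ (black ∷_) e∈)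
redFirst-complete (inside ∷ S) {f} bo with f zero ≟ᶜ black
... | yes f0 with e , e∈ ← redFirst-complete S (black-tail bo)
  = e , subst (λ c → c ∷ tabulate (swapRed e ∘ f ∘ suc) ∈ᴸ redFirst (inside ∷ S))
          (sym (trans (cong (swapRed e) f0) (swapRed-black e))) (∈-++⁺ˡ (∈-map⁺ (black ∷_) e∈))
... | no f0≢
  = f zero , subst (λ c → c ∷ tabulate (swapRed (f zero) ∘ f ∘ suc) ∈ᴸ redFirst (inside ∷ S))
          (sym (swapRed-self f0≢)) (∈-++⁺ʳ (map (black ∷_) (redFirst S)) (∈-map⁺ (red ∷_)
            (colourings-complete S (λ i∉ → trans (cong (swapRed (f zero)) (black-tail bo i∉)) (swapRed-black (f zero)))
              (λ i → ∈-all-colours _))))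

-- Codes and the vertex sets they decode to

module Coding (G : Graph n) (W : Subset n) where

  -- The same colouring can decode to different sets in the two readings, so each reading has its
  -- own constructor.
  data Code : Set where
    neighbourhood : Fin n → Code
    components    : Vec Colour n → Code
    separator     : Vec Colour n → Code

  -- Invariant under permutations of the nonblack colours, so it survives normalisation to
  -- `redFirst`. `RedAndOther` is not invariant: there red marks one particular component.
  Bichromatic : (Fin n → Colour) → Fin n → Set
  Bichromatic f x = ∃ λ u → ∃ λ v → Edge G x u × Edge G x v × f u ≢ black × f v ≢ black × f u ≢ f v

  RedAndOther : (Fin n → Colour) → Fin n → Set
  RedAndOther f x = ∃ λ u → ∃ λ v → Edge G x u × Edge G x v × f u ≡ red × (f v ≡ green ⊎ f v ≡ blue)

  Decoded : Code → Fin n → Set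
  Decoded (neighbourhood x) v = v ≡ x ⊎ Edge G x v
  Decoded (components w)    v = (v ∈ W × Vec.lookup w v ≡ black) ⊎ (v ∉ W × Bichromatic (Vec.lookup w) v)
  Decoded (separator w)     v =
    (v ∈ W × (Vec.lookup w v ≡ black ⊎ Vec.lookup w v ≡ blue)) ⊎ (v ∉ W × RedAndOther (Vec.lookup w) v)

  _codes_ : Code → Subset n → Set
  c codes Ω = ∀ v → (v ∈ Ω → Decoded c v) × (Decoded c v → v ∈ Ω)

  codes-unique : ∀ {c Ω Ω′} → c codes Ω → c codes Ω′ → Ω ≡ Ω′
  codes-unique p q = ⊆-antisym (λ {v} → proj₂ (q v) ∘ proj₁ (p v)) (λ {v} → proj₂ (p v) ∘ proj₁ (q v))

  codewords : List Code
  codewords = (map components (redFirst W) ++ map separator (oneBlue W)) ++ map neighbourhood (allFin n)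

  neighbourhood∈ : ∀ x → neighbourhood x ∈ᴸ codewords
  neighbourhood∈ x = ∈-++⁺ʳ (map components (redFirst W) ++ _) (∈-map⁺ neighbourhood (∈-allFin x))

  components∈ : ∀ {w} → w ∈ᴸ redFirst W → components w ∈ᴸ codewords
  components∈ w∈ = ∈-++⁺ˡ (∈-++⁺ˡ (∈-map⁺ components w∈))

  separator∈ : ∀ {w} → w ∈ᴸ oneBlue W → separator w ∈ᴸ codewords
  separator∈ w∈ = ∈-++⁺ˡ (∈-++⁺ʳ (map components (redFirst W)) (∈-map⁺ separator w∈))

  length-codewords : length codewords ≤ 4 ^ ∣ W ∣ + n
  length-codewords = begin
    length codewords
      ≡⟨ length-++ (map components (redFirst W) ++ map separator (oneBlue W)) ⟩
    length (map components (redFirst W) ++ map separator (oneBlue W)) + length (map neighbourhood (allFin n))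
      ≡⟨ cong₂ _+_ (trans (length-++ (map components (redFirst W)))
                          (cong₂ _+_ (length-map components (redFirst W)) (length-map separator (oneBlue W))))
                   (trans (length-map neighbourhood (allFin n)) (length-tabulate id)) ⟩
    length (redFirst W) + length (oneBlue W) + n
      ≤⟨ ℕ.+-monoˡ-≤ n (redFirst-or-oneBlue≤ W) ⟩
    4 ^ ∣ W ∣ + n ∎
    where open ℕ.≤-Reasoning

  bichromatic-map : ∀ {f g x} → (∀ {u} → g u ≡ black → f u ≡ black) → (∀ {u v} → g u ≡ g v → f u ≡ f v) →
    Bichromatic f x → Bichromatic g x
  bichromatic-map black⁻ eq⁻ (u , v , xu , xv , fu , fv , fuv) =
    u , v , xu , xv , fu ∘ black⁻ , fv ∘ black⁻ , fuv ∘ eq⁻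

  redAndOther-resp : ∀ {f g x} → (∀ u → g u ≡ f u) → RedAndOther f x → RedAndOther g x
  redAndOther-resp g≗f (u , v , xu , xv , fu , fv) =
    u , v , xu , xv , trans (g≗f u) fu , Sum.map (trans (g≗f v)) (trans (g≗f v)) fv

-- Encoding a maximal clique of a minimal triangulation

module _ {G H : Graph n} (minimal : IsMinimalTriangulation G H)
         {Ω : Subset n} (maximal : IsMaximalClique H Ω)
         {W : Subset n} (cover : IsVertexCover G W) where

  open Component G Ω
  open Coding G W

  Coded : Set
  Coded = ∃ λ c → c ∈ᴸ codewords × c codes Ω

  private
    uncovered-neighbour : ∀ {x v} → x ∉ W → Edge G x v → v ∈ W
    uncovered-neighbour {x} {v} x∉ e = [ (λ x∈ → contradiction x∈ x∉) , id ] (cover x v e)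

    common-component : ∀ {u v} → u ∈ Ω → v ∈ Ω → u ≢ v → ¬ Edge G u v →
      ¬ (∀ w → w ∉ Ω → Sees w u → ¬ Sees w v)
    common-component = nonadjacent⇒common-component {G = G} {H} minimal (proj₁ maximal)

  -- Another vertex of `Ω` not adjacent to `x` would see a component together with `x`, but `x` sees
  -- none.
  closed-neighbourhood-coded : ∀ {x} → x ∈ Ω → (∀ v → Edge G x v → v ∈ Ω) → Coded
  closed-neighbourhood-coded {x} x∈ nbrs∈ = neighbourhood x , neighbourhood∈ x , λ v →
    decode⁺ v , λ where
      (inj₁ refl) → x∈
      (inj₂ e)    → nbrs∈ v e
    where
    decode⁺ : ∀ v → v ∈ Ω → v ≡ x ⊎ Edge G x v
    decode⁺ v v∈ with v Fin.≟ x | edge? G x v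
    ... | yes v≡x | _      = inj₁ v≡x
    ... | no _    | yes xv = inj₂ xv
    ... | no v≢x  | no ¬xv = contradiction
      (λ w w∉ → λ (c , w~c , cx) _ → ~-∉ w∉ w~c (nbrs∈ c (edge-sym G cx)))
      (common-component x∈ v∈ (≢-sym v≢x) ¬xv)

  -- Vertices outside `W` have all their neighbours in `W`, so restricting `g` to `W` loses nothing
  -- there. For such a vertex outside `Ω`, the neighbours outside `Ω` lie in one component and share
  -- a colour; for one in `Ω`, two colours occur.
  components-coded : (g : Fin n → Colour) → (∀ v → g v ≢ black) →
    (∀ {u v} → u ∉ Ω → v ∉ Ω → u ~ v → g u ≡ g v) →
    (∀ {x} → x ∈ Ω → x ∉ W → ¬ (∀ {s t} → s ∉ Ω → t ∉ Ω → Edge G x s → Edge G x t → g s ≡ g t)) →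
    ¬ ¬ Coded
  components-coded g nonblack constant not-constant ¬coded =
    ¬¬-∀ {P = λ x → x ∈ Ω → x ∉ W → Bichromatic f x}
      (λ x ¬b → ¬b λ x∈ x∉W → contradiction (λ b → ¬b λ _ _ → b) (bichromatic x∈ x∉W))
      λ bichrom → ¬coded (components w , components∈ w∈ , λ v → decode⁺ bichrom v , decode⁻ v)
    where
    f : Fin n → Colour
    f v with v ∈? W | v ∈? Ω
    ... | yes _ | no _ = g v
    ... | _     | _    = black

    f-uncovered : BlackOutside W f
    f-uncovered {v} v∉W with v ∈? W | v ∈? Ω
    ... | yes v∈W | _     = contradiction v∈W v∉W
    ... | no _    | yes _ = refl
    ... | no _    | no _  = refl

    f-Ω : ∀ {v} → v ∈ Ω → f v ≡ black
    f-Ω {v} v∈ with v ∈? W | v ∈? Ω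
    ... | _     | no v∉ = contradiction v∈ v∉
    ... | yes _ | yes _ = refl
    ... | no _  | yes _ = refl

    f-outside : ∀ {v} → v ∈ W → v ∉ Ω → f v ≡ g v
    f-outside {v} v∈W v∉ with v ∈? W | v ∈? Ω
    ... | yes _  | no _   = refl
    ... | yes _  | yes v∈ = contradiction v∈ v∉
    ... | no v∉W | _      = contradiction v∈W v∉W

    f-nonblack : ∀ {v} → v ∈ W → v ∉ Ω → f v ≢ black
    f-nonblack v∈W v∉ fv = nonblack _ (trans (sym (f-outside v∈W v∉)) fv)

    bichromatic : ∀ {x} → x ∈ Ω → x ∉ W → ¬ ¬ Bichromatic f x
    bichromatic x∈ x∉W ¬b = not-constant x∈ x∉W λ {s} {t} s∉ t∉ xs xt →
      let s∈W = uncovered-neighbour x∉W xs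
          t∈W = uncovered-neighbour x∉W xt
      in decidable-stable (g s ≟ᶜ g t) λ gs≢gt →
        ¬b (s , t , xs , xt , f-nonblack s∈W s∉ , f-nonblack t∈W t∉ , λ fs≡ft →
            gs≢gt (trans (sym (f-outside s∈W s∉)) (trans fs≡ft (f-outside t∈W t∉))))

    -- The colours are permuted to reach `redFirst W`; blackness and equality of colours are
    -- preserved.
    e = proj₁ (redFirst-complete W f-uncovered)
    w∈ = proj₂ (redFirst-complete W f-uncovered)
    w = tabulate (swapRed e ∘ f)
    lookup-w : ∀ v → Vec.lookup w v ≡ swapRed e (f v)
    lookup-w = lookup∘tabulate (swapRed e ∘ f)

    black⁺ : ∀ {v} → f v ≡ black → Vec.lookup w v ≡ black
    black⁺ {v} fv = trans (lookup-w v) (trans (cong (swapRed e) fv) (swapRed-black e))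
    black⁻ : ∀ {v} → Vec.lookup w v ≡ black → f v ≡ black
    black⁻ {v} wv = swapRed-injective e (trans (sym (lookup-w v)) (trans wv (sym (swapRed-black e))))
    same⁺ : ∀ {u v} → f u ≡ f v → Vec.lookup w u ≡ Vec.lookup w v
    same⁺ {u} {v} fuv = trans (lookup-w u) (trans (cong (swapRed e) fuv) (sym (lookup-w v)))
    same⁻ : ∀ {u v} → Vec.lookup w u ≡ Vec.lookup w v → f u ≡ f v
    same⁻ {u} {v} wuv = swapRed-injective e (trans (sym (lookup-w u)) (trans wuv (lookup-w v)))

    decode⁺ : (∀ x → x ∈ Ω → x ∉ W → Bichromatic f x) → ∀ v → v ∈ Ω → Decoded (components w) v
    decode⁺ bichrom v v∈ with v ∈? W
    ... | yes v∈W = inj₁ (v∈W , black⁺ (f-Ω v∈))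
    ... | no v∉W  = inj₂ (v∉W , bichromatic-map black⁻ same⁻ (bichrom v v∈ v∉W))

    decode⁻ : ∀ v → Decoded (components w) v → v ∈ Ω
    decode⁻ v (inj₁ (v∈W , wv)) = decidable-stable (v ∈? Ω) λ v∉ → f-nonblack v∈W v∉ (black⁻ wv)
    decode⁻ x (inj₂ (x∉W , b)) with bichromatic-map {g = f} black⁺ same⁺ b
    ... | u , v , xu , xv , fu , fv , fuv = decidable-stable (x ∈? Ω) λ x∉ →
      let u∉ = fu ∘ f-Ω
          v∉ = fv ∘ f-Ω
      in fuv (trans (f-outside (uncovered-neighbour x∉W xu) u∉) (trans
           (constant u∉ v∉ (edge⇒~ u∉ x∉ (edge-sym G xu) ◅◅ edge⇒~ x∉ v∉ xv))
           (sym (f-outside (uncovered-neighbour x∉W xv) v∉))))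

  module _ (_~?_ : ∀ u v → Dec (u ~ v)) (sees? : ∀ u v → Dec (Sees u v)) where

    -- All vertices of Ω ∖ W then see the component of u, so Ω ∖ W is the part outside W of the
    -- separator N(C) of C; a vertex y ∈ Ω outside N(C) is adjacent to every vertex of Ω ∖ W that
    -- sees no component other than C.
    single-component-coded : ∀ {x u} → x ∈ Ω → x ∉ W → u ∉ Ω → Edge G x u →
      (∀ t → t ∉ Ω → Edge G x t → u ~ t) → Coded
    single-component-coded {x} {u} x∈ x∉W u∉ xu only-u with any? (λ y → (y ∈? Ω) ×-dec ¬? (sees? u y))
    ... | no none = contradiction
      (λ z z∈ → decidable-stable (sees? u z) λ ¬uz → none (z , z∈ , ¬uz))
      (no-full-component {G = G} {H} (proj₁ minimal) maximal u∉)
    ... | yes (y , y∈ , ¬uy) = separator w , separator∈ w∈ , λ v → decode⁺ v , decode⁻ v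
      where
      -- Distinct `x` and `z` outside the cover are nonadjacent, so they see a common component,
      -- which can only be that of `u`.
      all-see : ∀ {z} → z ∈ Ω → z ∉ W → Sees u z
      all-see {z} z∈ z∉W with x Fin.≟ z
      ... | yes refl = u , ε , edge-sym G xu
      ... | no x≢z   = decidable-stable (sees? u z) λ ¬uz →
        common-component x∈ z∈ x≢z (λ xz → z∉W (uncovered-neighbour x∉W xz))
          λ w w∉ (c , w~c , cx) wz → ¬uz (Sees-resp (only-u c (~-∉ w∉ w~c) (edge-sym G cx) ◅◅ ~-sym w~c) wz)

      y∈W : y ∈ W
      y∈W = decidable-stable (y ∈? W) (¬uy ∘ all-see y∈)

      -- The constructors record why `v` has its colour, so facts about `f` follow by matching on
      -- the reason.
      data Class (v : Fin n) : Colour → Set where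
        uncovered : v ∉ W → Class v black
        chosen    : v ≡ y → Class v blue
        clique    : v ∈ W → v ∈ Ω → v ≢ y → Class v black
        within    : v ∈ W → u ~ v → Class v red
        beyond    : v ∈ W → v ∉ Ω → ¬ u ~ v → Class v green

      classify : ∀ v → ∃ (Class v)
      classify v with v ∈? W | v Fin.≟ y | v ∈? Ω | u ~? v
      ... | no v∉W  | _       | _      | _       = _ , uncovered v∉W
      ... | yes _   | yes v≡y | _      | _       = _ , chosen v≡y
      ... | yes v∈W | no v≢y  | yes v∈ | _       = _ , clique v∈W v∈ v≢y
      ... | yes v∈W | no _    | no _   | yes u~v = _ , within v∈W u~v
      ... | yes v∈W | no _    | no v∉  | no ¬u~v = _ , beyond v∈W v∉ ¬u~v

      f : Fin n → Colour
      f v = proj₁ (classify v)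

      class : ∀ v → Class v (f v)
      class v = proj₂ (classify v)

      class-uncovered : ∀ {v c} → v ∉ W → Class v c → c ≡ black
      class-uncovered v∉W (uncovered _)      = refl
      class-uncovered v∉W (chosen refl)      = contradiction y∈W v∉W
      class-uncovered v∉W (clique v∈W _ _)     = contradiction v∈W v∉W
      class-uncovered v∉W (within v∈W _)     = contradiction v∈W v∉W
      class-uncovered v∉W (beyond v∈W _ _)   = contradiction v∈W v∉W

      class-blue : ∀ {v c} → Class v c → c ≡ blue → v ≡ y
      class-blue (chosen v≡y) _ = v≡y

      class-y : ∀ {c} → Class y c → c ≡ blue
      class-y (uncovered y∉W)  = contradiction y∈W y∉W
      class-y (chosen _)       = refl
      class-y (clique _ _ y≢y) = contradiction refl y≢y
      class-y (within _ u~y)   = contradiction y∈ (~-∉ u∉ u~y)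
      class-y (beyond _ y∉ _)  = contradiction y∈ y∉

      class-within : ∀ {v c} → v ∈ W → u ~ v → Class v c → c ≡ red
      class-within v∈W u~v (uncovered v∉W)   = contradiction v∈W v∉W
      class-within v∈W u~v (chosen refl)     = contradiction y∈ (~-∉ u∉ u~v)
      class-within v∈W u~v (clique _ v∈ _)     = contradiction v∈ (~-∉ u∉ u~v)
      class-within v∈W u~v (within _ _)      = refl
      class-within v∈W u~v (beyond _ _ ¬u~v) = contradiction u~v ¬u~v

      class-red : ∀ {v c} → Class v c → c ≡ red → u ~ v
      class-red (within _ u~v) _ = u~v

      class-beyond : ∀ {v c} → v ∈ W → v ∉ Ω → ¬ u ~ v → Class v c → c ≡ green
      class-beyond v∈W v∉ ¬u~v (uncovered v∉W) = contradiction v∈W v∉W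
      class-beyond v∈W v∉ ¬u~v (chosen refl)   = contradiction y∈ v∉
      class-beyond v∈W v∉ ¬u~v (clique _ v∈ _)   = contradiction v∈ v∉
      class-beyond v∈W v∉ ¬u~v (within _ u~v)  = contradiction u~v ¬u~v
      class-beyond v∈W v∉ ¬u~v (beyond _ _ _)  = refl

      class-green : ∀ {v c} → Class v c → c ≡ green → v ∉ Ω × ¬ u ~ v
      class-green (beyond _ v∉ ¬u~v) _ = v∉ , ¬u~v

      class-Ω : ∀ {v c} → v ∈ Ω → Class v c → c ≡ black ⊎ c ≡ blue
      class-Ω v∈ (uncovered _)   = inj₁ refl
      class-Ω v∈ (chosen _)      = inj₂ refl
      class-Ω v∈ (clique _ _ _)    = inj₁ refl
      class-Ω v∈ (within _ u~v)  = contradiction v∈ (~-∉ u∉ u~v)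
      class-Ω v∈ (beyond _ v∉ _) = contradiction v∈ v∉

      class-Ω⁻ : ∀ {v c} → v ∈ W → Class v c → c ≡ black ⊎ c ≡ blue → v ∈ Ω
      class-Ω⁻ v∈W (uncovered v∉W) _         = contradiction v∈W v∉W
      class-Ω⁻ v∈W (chosen refl)   _         = y∈
      class-Ω⁻ v∈W (clique _ v∈ _)   _         = v∈
      class-Ω⁻ v∈W (within _ _)    (inj₁ ())
      class-Ω⁻ v∈W (within _ _)    (inj₂ ())
      class-Ω⁻ v∈W (beyond _ _ _)  (inj₁ ())
      class-Ω⁻ v∈W (beyond _ _ _)  (inj₂ ())

      w : Vec Colour n
      w = tabulate f

      lookup-w : ∀ v → Vec.lookup w v ≡ f v
      lookup-w = lookup∘tabulate f

      w∈ : w ∈ᴸ oneBlue W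
      w∈ = oneBlue-complete W (λ v∉W → class-uncovered v∉W (class _)) y∈W (class-y (class y))
             (λ {v} → class-blue (class v))

      redAndOther : ∀ {v} → v ∈ Ω → v ∉ W → RedAndOther f v
      redAndOther {v} v∈ v∉W =
        let c , u~c , cv = all-see v∈ v∉W
            b , vb , fb  = second
        in c , b , edge-sym G cv , vb ,
           class-within (uncovered-neighbour v∉W (edge-sym G cv)) u~c (class c) , fb
        where
        second : ∃ λ b → Edge G v b × (f b ≡ green ⊎ f b ≡ blue)
        second with any? (λ t → ¬? (t ∈? Ω) ×-dec (edge? G v t ×-dec ¬? (u ~? t)))
        ... | yes (t , t∉ , vt , ¬u~t) =
          t , vt , inj₁ (class-beyond (uncovered-neighbour v∉W vt) t∉ ¬u~t (class t))
        -- If `v` sees no other component, it is adjacent to `y`: otherwise both would see a common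
        -- component, which could only be that of `u`, and `y` does not see it.
        ... | no none = y , vy , inj₂ (class-y (class y))
          where
          vy : Edge G v y
          vy = decidable-stable (edge? G v y) λ ¬vy →
            common-component v∈ y∈ (λ { refl → v∉W y∈W }) ¬vy λ w w∉ (d , w~d , dv) wy →
              ¬uy (Sees-resp (decidable-stable (u ~? d) (λ ¬u~d → none (d , ~-∉ w∉ w~d , edge-sym G dv , ¬u~d))
                               ◅◅ ~-sym w~d) wy)

      decode⁺ : ∀ v → v ∈ Ω → Decoded (separator w) v
      decode⁺ v v∈ with v ∈? W
      ... | yes v∈W = inj₁ (v∈W , Sum.map (trans (lookup-w v)) (trans (lookup-w v)) (class-Ω v∈ (class v)))
      ... | no v∉W  = inj₂ (v∉W , redAndOther-resp lookup-w (redAndOther v∈ v∉W))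

      decode⁻ : ∀ v → Decoded (separator w) v → v ∈ Ω
      decode⁻ v (inj₁ (v∈W , wv)) =
        class-Ω⁻ v∈W (class v) (Sum.map (trans (sym (lookup-w v))) (trans (sym (lookup-w v))) wv)
      -- If `v` were outside `Ω`, its red neighbour would put it in the component of `u`. A green
      -- neighbour would then lie there too, and a blue one would be `y`, seen by that component.
      decode⁻ v (inj₂ (v∉W , ro)) with redAndOther-resp (sym ∘ lookup-w) ro
      ... | a , b , va , vb , fa , fb = decidable-stable (v ∈? Ω) λ v∉ →
        let u~a = class-red (class a) fa
            u~v = u~a ◅◅ edge⇒~ (~-∉ u∉ u~a) v∉ (edge-sym G va)
        in [ (λ fb≡green → let b∉ , ¬u~b = class-green (class b) fb≡green in
                 ¬u~b (u~v ◅◅ edge⇒~ v∉ b∉ vb))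
           , (λ fb≡blue → ¬uy (v , u~v , subst (Edge G v) (class-blue (class b) fb≡blue) vb))
           ] fb

    -- The components seen by the vertices of Ω ∖ W form an intersecting family of sets of size
    -- at least two, which is properly 3-coloured from a minimal member E: one element of E, the
    -- rest of E, and everything outside E.
    many-components-coded :
      (∀ {x u} → x ∈ Ω → x ∉ W → u ∉ Ω → Edge G x u → ¬ (∀ t → t ∉ Ω → Edge G x t → u ~ t)) →
      ¬ ¬ Coded
    many-components-coded many ¬coded with any? (λ x → (x ∈? Ω) ×-dec ¬? (x ∈? W))
    -- When `Ω` is contained in `W`, no vertex has to see two colours and a single colour serves.
    ... | no none = components-coded (λ _ → red) (λ _ ()) (λ _ _ _ → refl)
            (λ x∈ x∉W → contradiction (_ , x∈ , x∉W) none) ¬coded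
    ... | yes (x , x∈ , x∉W) = ¬-by-minimal seen (λ x → x ∈ Ω × x ∉ W)
            (λ x₀ (x₀∈ , x₀∉W) min → from-minimal x₀∈ x₀∉W (λ y y∈ y∉W → min y (y∈ , y∉W))) x (x∈ , x∉W)
      where
      seen-by? : ∀ x v → Dec (v ∉ Ω × Sees v x)
      seen-by? x v = ¬? (v ∈? Ω) ×-dec sees? v x

      -- Counting the vertices in the seen components measures the family without forming the
      -- quotient by `~`; a proper subfamily still has a smaller count.
      seen : Fin n → ℕ
      seen x = ∣ ⟦ seen-by? x ⟧ ∣

      -- Without such a neighbour, `Ω` is the closed neighbourhood of `x` and already has a code.
      outside-neighbour : ∀ {x} → x ∈ Ω → ∃ λ t → t ∉ Ω × Edge G x t
      outside-neighbour {x} x∈ with any? (λ t → ¬? (t ∈? Ω) ×-dec edge? G x t)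
      ... | yes t   = t
      ... | no none = contradiction
        (closed-neighbourhood-coded x∈ λ v xv → decidable-stable (v ∈? Ω) λ v∉ → none (v , v∉ , xv)) ¬coded

      module _ {x₀} (x₀∈ : x₀ ∈ Ω) (x₀∉W : x₀ ∉ W) (min : ∀ y → y ∈ Ω → y ∉ W → seen x₀ ≤ seen y) where

        u₀ : Fin n
        u₀ = proj₁ (outside-neighbour x₀∈)
        u₀∉ : u₀ ∉ Ω
        u₀∉ = proj₁ (proj₂ (outside-neighbour x₀∈))
        u₀-sees : Sees u₀ x₀
        u₀-sees = u₀ , ε , edge-sym G (proj₂ (proj₂ (outside-neighbour x₀∈)))

        data Class (v : Fin n) : Colour → Set where
          first  : u₀ ~ v → Class v red
          second : ¬ u₀ ~ v → Sees v x₀ → Class v green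
          third  : ¬ Sees v x₀ → Class v blue

        classify : ∀ v → ∃ (Class v)
        classify v with u₀ ~? v | sees? v x₀
        ... | yes u₀~v | _     = _ , first u₀~v
        ... | no ¬u₀~v | yes s = _ , second ¬u₀~v s
        ... | no _     | no ¬s = _ , third ¬s

        g : Fin n → Colour
        g v = proj₁ (classify v)

        class : ∀ v → Class v (g v)
        class v = proj₂ (classify v)

        class-nonblack : ∀ {v c} → Class v c → c ≢ black
        class-nonblack (first _)    ()
        class-nonblack (second _ _) ()
        class-nonblack (third _)    ()

        class-constant : ∀ {u v a b} → u ~ v → Class u a → Class v b → a ≡ b
        class-constant u~v (first _)        (first _)        = refl
        class-constant u~v (first u₀~u)     (second ¬u₀~v _) = contradiction (u₀~u ◅◅ u~v) ¬u₀~v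
        class-constant u~v (first u₀~u)     (third ¬sv)      =
          contradiction (Sees-resp (~-sym (u₀~u ◅◅ u~v)) u₀-sees) ¬sv
        class-constant u~v (second ¬u₀~u _) (first u₀~v)     = contradiction (u₀~v ◅◅ ~-sym u~v) ¬u₀~u
        class-constant u~v (second _ _)     (second _ _)     = refl
        class-constant u~v (second _ su)    (third ¬sv)      = contradiction (Sees-resp (~-sym u~v) su) ¬sv
        class-constant u~v (third ¬su)      (first u₀~v)     =
          contradiction (Sees-resp (u~v ◅◅ ~-sym u₀~v) u₀-sees) ¬su
        class-constant u~v (third ¬su)      (second _ sv)    = contradiction (Sees-resp u~v sv) ¬su
        class-constant u~v (third _)        (third _)        = refl

        class-red : ∀ {v} → Class v red → u₀ ~ v
        class-red (first u₀~v) = u₀~v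

        class-green : ∀ {v} → Class v green → ¬ u₀ ~ v × Sees v x₀
        class-green (second ¬u₀~v sv) = ¬u₀~v , sv

        class-blue : ∀ {v} → Class v blue → ¬ Sees v x₀
        class-blue (third ¬sv) = ¬sv

        -- All red means a single component, against `many`. All green gives a subfamily of E
        -- without the component of `u₀`, against minimality. All blue gives a family disjoint from
        -- E, although `x` either is `x₀` or is nonadjacent to it and shares a component with it.
        not-monochromatic : ∀ {x t c} → x ∈ Ω → x ∉ W → t ∉ Ω → Edge G x t → Class t c →
          ¬ (∀ s → s ∉ Ω → Edge G x s → Class s c)
        not-monochromatic x∈ x∉W t∉ xt (first u₀~t) mono =
          many x∈ x∉W t∉ xt λ s s∉ xs → ~-sym u₀~t ◅◅ class-red (mono s s∉ xs)
        not-monochromatic {x} x∈ x∉W t∉ xt (second _ _) mono =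
          ℕ.<⇒≱ (∣⟦⟧∣-< (seen-by? x) (seen-by? x₀)
                   (λ (v∉ , s , v~s , sx) → v∉ , Sees-resp v~s (proj₂ (nbr-green s (~-∉ v∉ v~s) sx)))
                   (u₀∉ , u₀-sees)
                   (λ (_ , s , u₀~s , sx) → proj₁ (nbr-green s (~-∉ u₀∉ u₀~s) sx) u₀~s))
                (min x x∈ x∉W)
          where
          nbr-green : ∀ s → s ∉ Ω → Edge G s x → ¬ u₀ ~ s × Sees s x₀
          nbr-green s s∉ sx = class-green (mono s s∉ (edge-sym G sx))
        not-monochromatic {x} {t} x∈ x∉W t∉ xt (third ¬st) mono with x Fin.≟ x₀
        ... | yes refl = ¬st (t , ε , edge-sym G xt)
        ... | no x≢x₀  = common-component x∈ x₀∈ x≢x₀ (λ e → x₀∉W (uncovered-neighbour x∉W e))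
          λ w w∉ (s , w~s , sx) wx₀ →
            class-blue (mono s (~-∉ w∉ w~s) (edge-sym G sx)) (Sees-resp (~-sym w~s) wx₀)

        from-minimal : ⊥
        from-minimal = components-coded g (λ v → class-nonblack (class v))
          (λ {u} {v} _ _ u~v → class-constant u~v (class u) (class v))
          (λ {x} x∈ x∉W same → let t , t∉ , xt = outside-neighbour x∈ in
            not-monochromatic x∈ x∉W t∉ xt (class t)
              λ s s∉ xs → subst (Class s) (same s∉ t∉ xs xt) (class s))
          ¬coded

  -- The negated goal lets `~` and `Sees` be taken as decidable. A vertex of `Ω` outside `W` that
  -- sees a single component yields a code at once, so `many-components-coded` may assume there is
  -- none.
  maximal-clique-coded : ¬ ¬ Coded
  maximal-clique-coded ¬coded = ¬¬-decidable₂ _~_ λ _~?_ → ¬¬-decidable₂ Sees λ sees? →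
    many-components-coded _~?_ sees?
      (λ x∈ x∉W u∉ xu only-u → ¬coded (single-component-coded _~?_ sees? x∈ x∉W u∉ xu only-u)) ¬coded

-- Bounding the number of potential maximal cliques

-- Ranging over repetition-free lists expresses a bound on the number of sets without deciding
-- `IsPMC`.
theorem9 : ∀ (n k : ℕ) (G : Graph n) → HasVertexCoverOfSize G k →
    (L : List (Subset n)) → Unique L → All (IsPMC G) L →
    length L ≤ 4 ^ k + n
theorem9 n k G (W , cover , refl) L unique pmcs = ℕ.≤-trans
  (length-≤-of-codes _codes_ codes-unique unique λ Ω∈ →
    let H , minimal , maximal = All.lookup pmcs Ω∈ in maximal-clique-coded {G = G} {H} minimal maximal cover)
  length-codewords
  where open Coding G W
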